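{- Fix a positive integer $k$ and a permutation $\rho$. Then $\lim_{n\to\infty}\left(\operatorname{op}^*_{n,k}(\rho)\right)^{1/n}$ exists and is a real number in $[1,\infty)$.
   Context: For a permutation $\rho=\rho_1\cdots\rho_m\in\mathcal{S}_m$ and a sequence of pairwise disjoint (possibly empty) sets $B_1/B_2/\cdots/B_k$, we say it contains $\rho$ if there are indices $i_1<i_2<\cdots<i_m$ and elements $b_j\in B_{i_j}$ such that $b_1\cdots b_m$ is order-isomorphic to $\rho$ (i.e. $b_a<b_c$ iff $\rho_a<\rho_c$); otherwise it avoids $\rho$. $\operatorname{op}^*_{n,k}(\rho)$ is the number of sequences $B_1/\cdots/B_k$ of pairwise disjoint subsets of $[n]$ (blocks are allowed to be empty; order of blocks matters, order within a block does not) with $\bigcup_i B_i=[n]$ that avoid $\rho$.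
   Formalization: The permutation ρ is required to have length at least 2: for ρ of length 0 or 1 every such sequence of blocks with n ≥ 1 contains ρ, so op* is 0 and the limit is 0, outside [1,∞). -}

module Defs where

import Algebra.Definitions.RawSemiring
open import Data.Bool using () renaming (_≟_ to _≟ᵇ_)
open import Data.Fin as Fin using (Fin)
import Data.Fin.Properties as Fin
open import Data.Fin.Permutation using (Permutation′; _⟨$⟩ʳ_)
open import Data.Fin.Subset using (Subset; inside; outside; _∈_; _∩_; ⋃; ⊤; Empty)
open import Data.Fin.Subset.Properties using (_∈?_; nonempty?)
open import Data.Integer using (+_)
open import Data.List using (List; []; _∷_; length; filter; allFin; cartesianProductWith)
import Data.List.Membership.Propositional as List
open import Data.List.Membership.Propositional.Properties using (∈-cartesianProductWith⁺; ∈-allFin)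
open import Data.List.Relation.Unary.Any as Any using (here; there)
import Data.List.Relation.Unary.All as All
import Data.List.Relation.Unary.AllPairs as AllPairs
open import Data.List.Relation.Unary.Unique.Propositional using (Unique)
open import Data.List.Relation.Unary.Unique.Propositional.Properties using (cartesianProductWith⁺)
open import Data.Nat as ℕ using (ℕ; zero; suc; NonZero)
open import Data.Product using (∃; ∃-syntax; Σ-syntax; _×_; _,_)
open import Data.Rational as ℚ using (ℚ; 0ℚ; 1ℚ; _/_)
import Data.Rational.Properties as ℚ
open import Data.Sum using (_⊎_; inj₁; inj₂)
open import Data.Vec using (Vec; []; _∷_; lookup; toList)
open import Data.Vec.Properties using (≡-dec; ∷-injective)
open import Function using (_⇔_; mk⇔; Equivalence)
open import Relation.Binary.PropositionalEquality using (_≡_; _≢_; refl; sym; trans; cong; subst)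
open import Relation.Nullary using (¬_; Dec; yes; no; ¬?; _×-dec_; _→-dec_)
open import Relation.Nullary.Decidable using (map′)
open import Relation.Unary using (Decidable)

open Algebra.Definitions.RawSemiring ℚ.+-*-rawSemiring using (_^_)

-- Avoidance in sequences of blocks.  The ground set [n] is Fin n.

Blocks : ℕ → ℕ → Set
Blocks n k = Vec (Subset n) k

Disjoint : ∀ {n k} → Blocks n k → Set
Disjoint B = ∀ i j → i ≢ j → Empty (lookup B i ∩ lookup B j)

Covers : ∀ {n k} → Blocks n k → Set
Covers B = ⋃ (toList B) ≡ ⊤

Increasing : ∀ {k m} → Vec (Fin k) m → Set
Increasing i = ∀ a c → a Fin.< c → lookup i a Fin.< lookup i c

OrderIsomorphic : ∀ {n m} → Vec (Fin n) m → Permutation′ m → Set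
OrderIsomorphic b ρ =
  ∀ a c → (lookup b a Fin.< lookup b c) ⇔ ((ρ ⟨$⟩ʳ a) Fin.< (ρ ⟨$⟩ʳ c))

Contains : ∀ {n k m} → Permutation′ m → Blocks n k → Set
Contains {n} {k} {m} ρ B =
  Σ[ i ∈ Vec (Fin k) m ] Σ[ b ∈ Vec (Fin n) m ]
    Increasing i ×
    (∀ j → lookup b j ∈ lookup B (lookup i j)) ×
    OrderIsomorphic b ρ

Avoids : ∀ {n k m} → Permutation′ m → Blocks n k → Set
Avoids ρ B = ¬ Contains ρ B

Counted : ∀ {n k m} → Permutation′ m → Blocks n k → Set
Counted ρ B = Disjoint B × Covers B × Avoids ρ B

vectors : ∀ {A : Set} → List A → (n : ℕ) → List (Vec A n)
vectors xs zero    = [] ∷ []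
vectors xs (suc n) = cartesianProductWith _∷_ xs (vectors xs n)

vectors-complete : ∀ {A : Set} {xs : List A} → (∀ x → x List.∈ xs) →
                   ∀ {n} (v : Vec A n) → v List.∈ vectors xs n
vectors-complete all []      = here refl
vectors-complete all (x ∷ v) =
  ∈-cartesianProductWith⁺ _∷_ (all x) (vectors-complete all v)

vectors-unique : ∀ {A : Set} {xs : List A} → Unique xs → ∀ n → Unique (vectors xs n)
vectors-unique u zero    = All.[] AllPairs.∷ AllPairs.[]
vectors-unique u (suc n) =
  cartesianProductWith⁺ _∷_ ∷-injective u (vectors-unique u n)

subsets : (n : ℕ) → List (Subset n)
subsets = vectors (outside ∷ inside ∷ [])

subsets-complete : ∀ {n} (p : Subset n) → p List.∈ subsets n
subsets-complete = vectors-complete λ where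
  outside → here refl
  inside  → there (here refl)

subsets-unique : ∀ n → Unique (subsets n)
subsets-unique = vectors-unique (((λ ()) All.∷ All.[]) AllPairs.∷ All.[] AllPairs.∷ AllPairs.[])

allBlocks : (n k : ℕ) → List (Blocks n k)
allBlocks n = vectors (subsets n)

allBlocks-complete : ∀ {n k} (B : Blocks n k) → B List.∈ allBlocks n k
allBlocks-complete = vectors-complete subsets-complete

allBlocks-unique : ∀ n k → Unique (allBlocks n k)
allBlocks-unique n = vectors-unique (subsets-unique n)

∃-vec? : ∀ {k m} {P : Vec (Fin k) m → Set} → Decidable P → Dec (∃ P)
∃-vec? {k} {m} P? = map′ Any.satisfied
  (λ (v , p) → List.lose (vectors-complete (∈-allFin {k}) v) p)
  (Any.any? P? (vectors (allFin k) m))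

_⇔?_ : ∀ {A B : Set} → Dec A → Dec B → Dec (A ⇔ B)
a? ⇔? b? = map′ (λ (f , g) → mk⇔ f g) (λ e → Equivalence.to e , Equivalence.from e)
  ((a? →-dec b?) ×-dec (b? →-dec a?))

disjoint? : ∀ {n k} → Decidable (Disjoint {n} {k})
disjoint? B = Fin.all? λ i → Fin.all? λ j →
  ¬? (i Fin.≟ j) →-dec ¬? (nonempty? (lookup B i ∩ lookup B j))

covers? : ∀ {n k} → Decidable (Covers {n} {k})
covers? B = ≡-dec _≟ᵇ_ (⋃ (toList B)) ⊤

contains? : ∀ {n k m} (ρ : Permutation′ m) → Decidable (Contains {n} {k} ρ)
contains? ρ B = ∃-vec? λ i → ∃-vec? λ b →
  (Fin.all? λ a → Fin.all? λ c → (a Fin.<? c) →-dec (lookup i a Fin.<? lookup i c)) ×-dec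
  (Fin.all? λ j → lookup b j ∈? lookup B (lookup i j)) ×-dec
  (Fin.all? λ a → Fin.all? λ c →
     (lookup b a Fin.<? lookup b c) ⇔? ((ρ ⟨$⟩ʳ a) Fin.<? (ρ ⟨$⟩ʳ c)))

counted? : ∀ {n k m} (ρ : Permutation′ m) → Decidable (Counted {n} {k} ρ)
counted? ρ B = disjoint? B ×-dec covers? B ×-dec ¬? (contains? ρ B)

-- When m ≤ 1 every cover of a nonempty Fin n contains ρ, so op* n k ρ is 0 for
-- all n ≥ 1; when m ≥ 2 and k ≥ 1 it is at least 1.
op* : (n k : ℕ) {m : ℕ} → Permutation′ m → ℕ
op* n k ρ = length (filter (counted? ρ) (allBlocks n k))

-- Real numbers as two-sided Dedekind cuts of ℚ:
-- Lower q means q < x and Upper q means x < q.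

record ℝ : Set₁ where
  field
    Lower Upper : ℚ → Set
    lower-inhabited : ∃ Lower
    upper-inhabited : ∃ Upper
    lower-rounded   : ∀ q → Lower q ⇔ (∃[ r ] q ℚ.< r × Lower r)
    upper-rounded   : ∀ q → Upper q ⇔ (∃[ r ] r ℚ.< q × Upper r)
    disjoint        : ∀ q → ¬ (Lower q × Upper q)
    located         : ∀ q r → q ℚ.< r → Lower q ⊎ Upper r

open ℝ public

infix 4 _<ℝ_ _≤ℝ_

_<ℝ_ : ℝ → ℝ → Set
x <ℝ y = ∃[ q ] Upper x q × Lower y q

_≤ℝ_ : ℝ → ℝ → Set
x ≤ℝ y = ∀ q → Lower x q → Lower y q

module ℚ-Arithmetic where
  p-1<p : ∀ p → p ℚ.- 1ℚ ℚ.< p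
  p-1<p p = subst (p ℚ.- 1ℚ ℚ.<_) (ℚ.+-identityʳ p)
    (ℚ.+-monoʳ-< p (ℚ.negative⁻¹ (ℚ.- 1ℚ)))

  p<p+1 : ∀ p → p ℚ.< p ℚ.+ 1ℚ
  p<p+1 p = subst (ℚ._< p ℚ.+ 1ℚ) (ℚ.+-identityʳ p)
    (ℚ.+-monoʳ-< p (ℚ.positive⁻¹ 1ℚ))

  p+q-q : ∀ p q → (p ℚ.+ q) ℚ.- q ≡ p
  p+q-q p q = trans (ℚ.+-assoc p q (ℚ.- q))
    (trans (cong (p ℚ.+_) (ℚ.+-inverseʳ q)) (ℚ.+-identityʳ p))

  p-q+q : ∀ p q → (p ℚ.- q) ℚ.+ q ≡ p
  p-q+q p q = trans (ℚ.+-assoc p (ℚ.- q) q)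
    (trans (cong (p ℚ.+_) (ℚ.+-inverseˡ q)) (ℚ.+-identityʳ p))

open ℚ-Arithmetic

fromℚ : ℚ → ℝ
fromℚ p = record
  { Lower           = ℚ._< p
  ; Upper           = p ℚ.<_
  ; lower-inhabited = p ℚ.- 1ℚ , p-1<p p
  ; upper-inhabited = p ℚ.+ 1ℚ , p<p+1 p
  ; lower-rounded   = λ q → mk⇔ ℚ.<-dense (λ (_ , q<r , r<p) → ℚ.<-trans q<r r<p)
  ; upper-rounded   = λ q → mk⇔
      (λ p<q → let r , p<r , r<q = ℚ.<-dense p<q in r , r<q , p<r)
      (λ (_ , r<q , p<r) → ℚ.<-trans p<r r<q)
  ; disjoint        = λ q (q<p , p<q) → ℚ.<-asym q<p p<q
  ; located         = loc
  }
  where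
  loc : ∀ q r → q ℚ.< r → (q ℚ.< p) ⊎ (p ℚ.< r)
  loc q r q<r with q ℚ.<? p
  ... | yes q<p = inj₁ q<p
  ... | no  q≮p = inj₂ (ℚ.≤-<-trans (ℚ.≮⇒≥ q≮p) q<r)

1ℝ : ℝ
1ℝ = fromℚ 1ℚ

infixl 6 _⊕_

-- The sum of a real and a rational.
_⊕_ : ℝ → ℚ → ℝ
x ⊕ ε = record
  { Lower           = λ q → Lower x (q ℚ.- ε)
  ; Upper           = λ q → Upper x (q ℚ.- ε)
  ; lower-inhabited = let q , l = lower-inhabited x in
      q ℚ.+ ε , subst (Lower x) (sym (p+q-q q ε)) l
  ; upper-inhabited = let q , u = upper-inhabited x in
      q ℚ.+ ε , subst (Upper x) (sym (p+q-q q ε)) u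
  ; lower-rounded   = λ q → mk⇔
      (λ l → let r , q<r , l′ = Equivalence.to (lower-rounded x (q ℚ.- ε)) l in
        r ℚ.+ ε , subst (ℚ._< r ℚ.+ ε) (p-q+q q ε) (ℚ.+-monoˡ-< ε q<r)
                , subst (Lower x) (sym (p+q-q r ε)) l′)
      (λ (r , q<r , l) → Equivalence.from (lower-rounded x (q ℚ.- ε))
        (r ℚ.- ε , ℚ.+-monoˡ-< (ℚ.- ε) q<r , l))
  ; upper-rounded   = λ q → mk⇔
      (λ u → let r , r<q , u′ = Equivalence.to (upper-rounded x (q ℚ.- ε)) u in
        r ℚ.+ ε , subst (r ℚ.+ ε ℚ.<_) (p-q+q q ε) (ℚ.+-monoˡ-< ε r<q)
                , subst (Upper x) (sym (p+q-q r ε)) u′)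
      (λ (r , r<q , u) → Equivalence.from (upper-rounded x (q ℚ.- ε))
        (r ℚ.- ε , ℚ.+-monoˡ-< (ℚ.- ε) r<q , u))
  ; disjoint        = λ q → disjoint x (q ℚ.- ε)
  ; located         = λ q r q<r → located x (q ℚ.- ε) (r ℚ.- ε) (ℚ.+-monoˡ-< (ℚ.- ε) q<r)
  }

-- | x - y | < ε, as x < y + ε and y < x + ε.
∣_-_∣<_ : ℝ → ℝ → ℚ → Set
∣ x - y ∣< ε = (x <ℝ y ⊕ ε) × (y <ℝ x ⊕ ε)

infix 4 _⟶_

-- Convergence of a sequence indexed by the positive integers.
_⟶_ : ((n : ℕ) → .{{NonZero n}} → ℝ) → ℝ → Set
u ⟶ x = ∀ ε → 0ℚ ℚ.< ε → ∃[ N ] (∀ n .{{_ : NonZero n}} → N ℕ.≤ n → ∣ u n - x ∣< ε)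

fromℕ : ℕ → ℚ
fromℕ a = + a / 1

module ℚ-Powers where
  0≤fromℕ : ∀ a → 0ℚ ℚ.≤ fromℕ a
  0≤fromℕ a = ℚ.nonNegative⁻¹ (fromℕ a) {{ℚ.normalize-nonNeg a 1}}

  *-mono-≤ : ∀ {p q r s} → 0ℚ ℚ.≤ p → 0ℚ ℚ.≤ s → p ℚ.≤ q → r ℚ.≤ s → p ℚ.* r ℚ.≤ q ℚ.* s
  *-mono-≤ {p} {q} {r} {s} 0≤p 0≤s p≤q r≤s = ℚ.≤-trans
    (ℚ.*-monoˡ-≤-nonNeg p {{ℚ.nonNegative 0≤p}} r≤s)
    (ℚ.*-monoʳ-≤-nonNeg s {{ℚ.nonNegative 0≤s}} p≤q)

  ^-nonNeg : ∀ {p} n → 0ℚ ℚ.≤ p → 0ℚ ℚ.≤ p ^ n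
  ^-nonNeg zero    0≤p = ℚ.nonNegative⁻¹ 1ℚ
  ^-nonNeg (suc n) 0≤p = *-mono-≤ ℚ.≤-refl (^-nonNeg n 0≤p) 0≤p (^-nonNeg n 0≤p)

  ^-mono-≤ : ∀ {p q} n → 0ℚ ℚ.≤ p → p ℚ.≤ q → p ^ n ℚ.≤ q ^ n
  ^-mono-≤ zero    0≤p p≤q = ℚ.≤-refl
  ^-mono-≤ (suc n) 0≤p p≤q =
    *-mono-≤ 0≤p (^-nonNeg n (ℚ.≤-trans 0≤p p≤q)) p≤q (^-mono-≤ n 0≤p p≤q)

  ^-pos : ∀ {p} n → 0ℚ ℚ.< p → 0ℚ ℚ.< p ^ n
  ^-pos zero        0<p = ℚ.positive⁻¹ 1ℚ
  ^-pos {p} (suc n) 0<p = subst (ℚ._< p ℚ.* p ^ n) (ℚ.*-zeroʳ p)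
    (ℚ.*-monoʳ-<-pos p {{ℚ.positive 0<p}} (^-pos n 0<p))

  ^-mono-< : ∀ {p q} n → .{{NonZero n}} → 0ℚ ℚ.≤ p → p ℚ.< q → p ^ n ℚ.< q ^ n
  ^-mono-< {p} {q} (suc n) 0≤p p<q = ℚ.≤-<-trans
    (ℚ.*-monoˡ-≤-nonNeg p {{ℚ.nonNegative 0≤p}} (^-mono-≤ n 0≤p (ℚ.<⇒≤ p<q)))
    (ℚ.*-monoˡ-<-pos (q ^ n) {{ℚ.positive (^-pos n (ℚ.≤-<-trans 0≤p p<q))}} p<q)

  1≤^ : ∀ {p} n → 1ℚ ℚ.≤ p → 1ℚ ℚ.≤ p ^ n
  1≤^ zero    1≤p = ℚ.≤-refl
  1≤^ {p} (suc n) 1≤p = subst (ℚ._≤ p ℚ.* p ^ n) (ℚ.*-identityˡ 1ℚ)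
    (*-mono-≤ (ℚ.nonNegative⁻¹ 1ℚ) (ℚ.≤-trans (ℚ.nonNegative⁻¹ 1ℚ) (1≤^ n 1≤p)) 1≤p (1≤^ n 1≤p))

  p≤p^n : ∀ {p} n → .{{NonZero n}} → 1ℚ ℚ.≤ p → p ℚ.≤ p ^ n
  p≤p^n {p} (suc n) 1≤p = subst (ℚ._≤ p ℚ.* p ^ n) (ℚ.*-identityʳ p)
    (ℚ.*-monoˡ-≤-nonNeg p {{ℚ.nonNegative (ℚ.≤-trans (ℚ.nonNegative⁻¹ 1ℚ) 1≤p)}} (1≤^ n 1≤p))

  0^n≡0 : ∀ n → .{{NonZero n}} → 0ℚ ^ n ≡ 0ℚ
  0^n≡0 (suc n) = ℚ.*-zeroˡ (0ℚ ^ n)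

open ℚ-Powers

-- The nonnegative n-th root of a, as
-- sup { r ≥ 0 : rⁿ ≤ a } = inf { r ≥ 0 : a ≤ rⁿ }.
root : (n : ℕ) → .{{NonZero n}} → ℕ → ℝ
root n a = record
  { Lower           = L
  ; Upper           = U
  ; lower-inhabited = ℚ.- 1ℚ , L-neg (ℚ.negative⁻¹ (ℚ.- 1ℚ))
  ; upper-inhabited = (A ℚ.+ 1ℚ) ℚ.+ 1ℚ , A ℚ.+ 1ℚ , p<p+1 (A ℚ.+ 1ℚ)
                    , ℚ.≤-trans 0≤A A≤A+1 , ℚ.≤-trans A≤A+1 (p≤p^n n 1≤A+1)
  ; lower-rounded   = λ q → mk⇔
      (λ (s , q<s , p) → let r , q<r , r<s = ℚ.<-dense q<s in r , q<r , s , r<s , p)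
      (λ (r , q<r , s , r<s , p) → s , ℚ.<-trans q<r r<s , p)
  ; upper-rounded   = λ q → mk⇔
      (λ (s , s<q , p) → let r , s<r , r<q = ℚ.<-dense s<q in r , r<q , s , s<r , p)
      (λ (r , r<q , s , s<r , p) → s , ℚ.<-trans s<r r<q , p)
  ; disjoint        = λ q ((r , q<r , _ , rⁿ≤a) , (s , s<q , 0≤s , a≤sⁿ)) →
      ℚ.<-irrefl refl (ℚ.<-≤-trans (^-mono-< n 0≤s (ℚ.<-trans s<q q<r))
                                   (ℚ.≤-trans rⁿ≤a a≤sⁿ))
  ; located         = loc
  }
  where
  A : ℚ
  A = fromℕ a

  L U : ℚ → Set
  L q = ∃[ r ] q ℚ.< r × 0ℚ ℚ.≤ r × r ^ n ℚ.≤ A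
  U q = ∃[ r ] r ℚ.< q × 0ℚ ℚ.≤ r × A ℚ.≤ r ^ n

  0≤A : 0ℚ ℚ.≤ A
  0≤A = 0≤fromℕ a

  A≤A+1 : A ℚ.≤ A ℚ.+ 1ℚ
  A≤A+1 = ℚ.<⇒≤ (p<p+1 A)

  1≤A+1 : 1ℚ ℚ.≤ A ℚ.+ 1ℚ
  1≤A+1 = subst (ℚ._≤ A ℚ.+ 1ℚ) (ℚ.+-identityˡ 1ℚ) (ℚ.+-monoˡ-≤ 1ℚ 0≤A)

  L-neg : ∀ {q} → q ℚ.< 0ℚ → L q
  L-neg q<0 = 0ℚ , q<0 , ℚ.≤-refl , subst (ℚ._≤ A) (sym (0^n≡0 n)) 0≤A

  loc : ∀ q r → q ℚ.< r → L q ⊎ U r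
  loc q r q<r with ℚ.<-dense q<r
  ... | s , q<s , s<r with ℚ.≤-total 0ℚ s
  ...   | inj₂ s≤0 = inj₁ (L-neg (ℚ.<-≤-trans q<s s≤0))
  ...   | inj₁ 0≤s with ℚ.≤-total (s ^ n) A
  ...     | inj₁ sⁿ≤A = inj₁ (s , q<s , 0≤s , sⁿ≤A)
  ...     | inj₂ A≤sⁿ = inj₂ (s , s<r , 0≤s , A≤sⁿ)

{-# OPTIONS --safe #-}

-- Sequences of k blocks partitioning [n] are words of length n over k letters, and containing ρ
-- means that the letters of some c₁ < ⋯ < cₘ occur as a subsequence in the order given by ρ⁻¹.
-- The limit is d = min (k, m - 1).  Words over d letters avoid ρ, so op* ≥ dⁿ.  Conversely,
-- read a word while matching the pattern of every such c greedily.  As long as no pattern is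
-- completed, among any m letters there is one that advances a pattern, so at most d letters
-- change nothing, and the total number of changes is bounded independently of n.  Hence op* is
-- at most C (d + 1/p)ⁿ for every p, with C independent of n, and Bernoulli's inequality absorbs
-- C into (d + 2/p)ⁿ for large n.
module Submission where

open import Defs
open import Algebra.Bundles using (CommutativeRing)
import Algebra.Definitions.RawSemiring
import Algebra.Properties.CommutativeSemiring.Exp
open import Data.Empty using (⊥)
open import Data.Fin as Fin using (Fin)
open import Data.Fin.Permutation using (Permutation′; _⟨$⟩ʳ_; _⟨$⟩ˡ_; inverseˡ)
import Data.Fin.Properties as Fin
import Data.Fin.Subset as Subset
import Data.Fin.Subset.Properties as Subset
open import Data.Integer as ℤ using (+_; +[1+_])
import Data.Integer.Properties as ℤ
open import Data.List as List using (List; []; _∷_; length; filter; allFin; concatMap; map; cartesianProductWith)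
import Data.List.Membership.DecPropositional as DecMembership
open import Data.List.Membership.Propositional using (_∈_; lose; find)
open import Data.List.Membership.Propositional.Properties
  using (∈-lookup; ∈-filter⁺; ∈-filter⁻; ∈-concatMap⁺; ∈-map⁺; ∈-map⁻; ∈-allFin)
import Data.List.Properties as List
open import Data.List.Relation.Binary.Subset.Propositional using (_⊆_)
open import Data.List.Relation.Unary.All as All using (All; []; _∷_)
import Data.List.Relation.Unary.All.Properties as All
open import Data.List.Relation.Unary.AllPairs using (AllPairs; []; _∷_)
import Data.List.Relation.Unary.AllPairs.Properties as AllPairs
open import Data.List.Relation.Unary.Any as Any using (Any; here)
import Data.List.Relation.Unary.Any.Properties as Any
open import Data.List.Relation.Unary.Unique.Propositional using (Unique)
import Data.List.Relation.Unary.Unique.Propositional.Properties as Unique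
open import Data.Nat using (ℕ; zero; suc; NonZero; _≤_; _<_; _+_; _*_; _^_; _⊓_; z≤n; s≤s; >-nonZero⁻¹)
open import Data.Nat.ListAction using (sum)
import Data.Nat.Properties as ℕ
open import Data.Nat.Tactic.RingSolver using (solve-∀)
open import Data.Product using (_×_; _,_; ∃-syntax; Σ-syntax; proj₁; proj₂)
open import Data.Rational as ℚ using (mkℚ; 0ℚ; 1ℚ; toℚᵘ)
import Data.Rational.Properties as ℚ
open import Data.Rational.Unnormalised as ℚᵘ using (mkℚᵘ; *≡*; *≤*)
import Data.Rational.Unnormalised.Properties as ℚᵘ
open import Data.Sum using (_⊎_; inj₁; inj₂)
open import Data.Vec as Vec using (Vec; []; _∷_; lookup)
import Data.Vec.Properties as Vec
open import Function using (_∘_; id; mk⇔)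
open import Relation.Binary.Definitions using (tri<; tri≈; tri>)
open import Relation.Binary.PropositionalEquality
  using (_≡_; _≢_; refl; sym; trans; cong; cong₂; subst; subst₂)
open import Relation.Nullary using (¬_; yes; no; does; contradiction; _→-dec_)
open import Relation.Nullary.Decidable using (dec-true)
open import Relation.Unary using (Decidable)

open Algebra.Definitions.RawSemiring ℚ.+-*-rawSemiring using () renaming (_^_ to _^ℚ_)
open Algebra.Properties.CommutativeSemiring.Exp
  (CommutativeRing.commutativeSemiring ℚ.+-*-commutativeRing) using (^-distrib-*)

-- Positions and lengths of lists.

lookup-AllPairs : ∀ {A : Set} {R : A → A → Set} {xs} → AllPairs R xs →
  ∀ {i j} → i Fin.< j → R (List.lookup xs i) (List.lookup xs j)
lookup-AllPairs (x ∷ _)  {Fin.zero}  {Fin.suc j} _         = All.lookup x (∈-lookup j)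
lookup-AllPairs (_ ∷ xs) {Fin.suc i} {Fin.suc j} (s≤s i<j) = lookup-AllPairs xs i<j

lookup-injective : ∀ {A : Set} {xs : List A} → Unique xs → ∀ {i j} → List.lookup xs i ≡ List.lookup xs j → i ≡ j
lookup-injective xs! {i} {j} eq with Fin.<-cmp i j
... | tri< i<j _ _ = contradiction eq (lookup-AllPairs xs! i<j)
... | tri≈ _ i≡j _ = i≡j
... | tri> _ _ j<i = contradiction (sym eq) (lookup-AllPairs xs! j<i)

-- Each position of `xs` goes to a position of the same element in `ys`, and this map is injective
-- because `xs` has no repetitions.
unique-⊆⇒length-≤ : ∀ {A : Set} {xs ys : List A} → Unique xs → xs ⊆ ys → length xs ≤ length ys
unique-⊆⇒length-≤ {xs = xs} {ys} xs! xs⊆ys = Fin.injective⇒≤ {f = f} λ {i} {j} eq → lookup-injective xs!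
  (trans (Any.lookup-index (xs⊆ys (∈-lookup i)))
    (trans (cong (List.lookup ys) eq) (sym (Any.lookup-index (xs⊆ys (∈-lookup j))))))
  where
  f : Fin (length xs) → Fin (length ys)
  f i = Any.index (xs⊆ys (∈-lookup i))

-- Elements satisfying `P` are charged both `X` and `Y`, so the complement of `P` never has to be
-- counted. The use is to count words by their first letter, with `P` the letters that leave the
-- state fixed and `s` in place of a division.
length-concatMap-≤ : ∀ {A B : Set} {P : A → Set} (P? : Decidable P) (f : A → List B) s {X Y} →
  (∀ a → P a → s * length (f a) ≤ X) → (∀ a → ¬ P a → s * length (f a) ≤ Y) →
  ∀ xs → s * length (concatMap f xs) ≤ length (filter P? xs) * X + length xs * Y
length-concatMap-≤ P? f s f≤X f≤Y [] = ℕ.≤-reflexive (ℕ.*-zeroʳ s)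
length-concatMap-≤ P? f s {X} {Y} f≤X f≤Y (x ∷ xs)
  rewrite List.length-++ (f x) {concatMap f xs} | ℕ.*-distribˡ-+ s (length (f x)) (length (concatMap f xs))
  with P? x
... | yes Px = begin
  s * length (f x) + s * length (concatMap f xs) ≤⟨ ℕ.+-mono-≤ (f≤X x Px) (length-concatMap-≤ P? f s f≤X f≤Y xs) ⟩
  X + (l * X + length xs * Y)                    ≡⟨ ℕ.+-assoc X (l * X) (length xs * Y) ⟨
  (X + l * X) + length xs * Y                    ≤⟨ ℕ.+-monoʳ-≤ (X + l * X) (ℕ.m≤n+m _ Y) ⟩
  (X + l * X) + (Y + length xs * Y)              ∎
  where open ℕ.≤-Reasoning; l = length (filter P? xs)
... | no ¬Px = begin
  s * length (f x) + s * length (concatMap f xs) ≤⟨ ℕ.+-mono-≤ (f≤Y x ¬Px) (length-concatMap-≤ P? f s f≤X f≤Y xs) ⟩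
  Y + (l * X + length xs * Y)                    ≡⟨ swap Y (l * X) (length xs * Y) ⟩
  l * X + (Y + length xs * Y)                    ∎
  where
  open ℕ.≤-Reasoning
  l = length (filter P? xs)
  swap : ∀ a b c → a + (b + c) ≡ b + (a + c)
  swap = solve-∀

-- Subsequences and greedy matching.

infix 4 _⊑_

-- Patterns are lists because matching shortens them; words are vectors because their length is
-- fixed. The empty pattern embeds into any remaining word, so a match may end early.
data _⊑_ {A : Set} : ∀ {n} → List A → Vec A n → Set where
  []   : ∀ {n} {w : Vec A n} → [] ⊑ w
  keep : ∀ {n a u} {w : Vec A n} → u ⊑ w → a ∷ u ⊑ a ∷ w
  skip : ∀ {n a u} {w : Vec A n} → u ⊑ w → u ⊑ a ∷ w

module _ {k : ℕ} where

  -- What remains to be matched of a pattern u by the greedy algorithm, after the letter a is read.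
  pop : Fin k → List (Fin k) → List (Fin k)
  pop a []      = []
  pop a (b ∷ u) with a Fin.≟ b
  ... | yes _ = u
  ... | no  _ = b ∷ u

  -- Used in contrapositive form: if `a ∷ w` avoids `u`, then its tail `w` avoids `pop a u`, so
  -- avoidance is passed on along the run.
  pop-⊑ : ∀ {n} a u {w : Vec (Fin k) n} → pop a u ⊑ w → u ⊑ a ∷ w
  pop-⊑ a []      e = []
  pop-⊑ a (b ∷ u) e with a Fin.≟ b
  ... | yes refl = keep e
  ... | no  _    = skip e

  pop-All : ∀ {P : Fin k → Set} a {u} → All P u → All P (pop a u)
  pop-All a []               = []
  pop-All a (_∷_ {b} Pb Pu) with a Fin.≟ b
  ... | yes _ = Pu
  ... | no  _ = Pb ∷ Pu

  pop-head-≢ : ∀ a u → pop a (a ∷ u) ≢ a ∷ u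
  pop-head-≢ a u eq with a Fin.≟ a
  ... | yes _   = contradiction (cong length eq) (ℕ.<⇒≢ (ℕ.n<1+n (length u)))
  ... | no  a≢a = a≢a refl

  pop-shrinks : ∀ a u → pop a u ≡ u ⊎ length (pop a u) < length u
  pop-shrinks a []      = inj₁ refl
  pop-shrinks a (b ∷ u) with a Fin.≟ b
  ... | yes _ = inj₂ ℕ.≤-refl
  ... | no  _ = inj₁ refl

  step : Fin k → List (List (Fin k)) → List (List (Fin k))
  step a = map (pop a)

  size : List (List (Fin k)) → ℕ
  size L = sum (map length L)

  -- The letters at which the automaton with states `L` and transitions `step` stays where it is.
  Loop : List (List (Fin k)) → Fin k → Set
  Loop L a = All (λ u → pop a u ≡ u) L

  loop? : ∀ L → Decidable (Loop L)
  loop? L a = All.all? (λ u → List.≡-dec Fin._≟_ (pop a u) u) L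

  -- No pattern ever grows, so shortening one of them lowers the sum of the lengths. A run therefore
  -- reads at most `size L` letters that are not loops.
  step-shrinks : ∀ a L → Loop L a ⊎ size (step a L) < size L
  step-shrinks a []      = inj₁ []
  step-shrinks a (u ∷ L) with pop-shrinks a u | step-shrinks a L
  ... | inj₁ eq | inj₁ all = inj₁ (eq ∷ all)
  ... | inj₁ eq | inj₂ lt  = inj₂ (ℕ.+-mono-≤-< (ℕ.≤-reflexive (cong length eq)) lt)
  ... | inj₂ lt | inj₁ all = inj₂ (ℕ.+-mono-<-≤ lt (ℕ.≤-reflexive (cong size (List.map-id-local all))))
  ... | inj₂ lt | inj₂ lt′ = inj₂ (ℕ.+-mono-< lt lt′)

  -- Counting the words that complete no pattern.

  open DecMembership (List.≡-dec (Fin._≟_ {k})) using (_∈?_)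

  -- A state that has `[]` in it is dead, since some pattern has been matched completely there.
  survivors : List (List (Fin k)) → (n : ℕ) → List (Vec (Fin k) n)
  survivors L n with [] ∈? L
  survivors L n       | yes _ = []
  survivors L zero    | no  _ = [] ∷ []
  survivors L (suc n) | no  _ = concatMap (λ a → map (a ∷_) (survivors (step a L) n)) (allFin k)

  survivors-complete : ∀ L {n} (w : Vec (Fin k) n) → All (λ u → ¬ u ⊑ w) L → w ∈ survivors L n
  survivors-complete L w av with [] ∈? L
  survivors-complete L w       av | yes p = contradiction [] (All.lookup av p)
  survivors-complete L []      av | no  _ = here refl
  survivors-complete L (a ∷ w) av | no  _ = ∈-concatMap⁺ _ (lose (∈-allFin a)
    (∈-map⁺ (a ∷_) (survivors-complete (step a L) w (All.map⁺ (All.map (λ {u} ¬e e → ¬e (pop-⊑ a u e)) av)))))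

  -- The invariant of the run: for every increasing `c`, some pattern has only letters of `c` left
  -- to match. It survives each step because `pop` only deletes letters.
  Hitting : ℕ → List (List (Fin k)) → Set
  Hitting m L = ∀ (c : Vec (Fin k) m) → Increasing c →
    Any (All (λ b → ∃[ j ] lookup c j ≡ b)) L

  step-hitting : ∀ {m} a {L} → Hitting m L → Hitting m (step a L)
  step-hitting a hit c inc = Any.map⁺ (Any.map (pop-All a) (hit c inc))

  -- If there were more than `m` loops, the first `m + 1` of them in increasing order would form a
  -- `c` to which `Hitting` applies.
  loops-≤ : ∀ {m L} → Hitting (suc m) L → ¬ [] ∈ L → length (filter (loop? L) (allFin k)) ≤ k ⊓ m
  loops-≤ {m} {L} hit []∉L = ℕ.⊓-glb
    (subst (length loops ≤_) (List.length-tabulate {n = k} id) (List.length-filter (loop? L) (allFin k)))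
    (ℕ.≮⇒≥ impossible)
    where
    loops = filter (loop? L) (allFin k)

    sorted : AllPairs Fin._<_ loops
    sorted = AllPairs.filter⁺ (loop? L) (AllPairs.tabulate⁺-< id)

    module _ (m<l : m < length loops) where
      letter : Fin (suc m) → Fin k
      letter j = List.lookup loops (Fin.inject≤ j m<l)

      c : Vec (Fin k) (suc m)
      c = Vec.tabulate letter

      c-loop : ∀ j → Loop L (lookup c j)
      c-loop j = subst (Loop L) (sym (Vec.lookup∘tabulate letter j))
        (proj₂ (∈-filter⁻ (loop? L) {xs = allFin k} (∈-lookup (Fin.inject≤ j m<l))))

      c-increasing : Increasing c
      c-increasing i j i<j
        rewrite Vec.lookup∘tabulate letter i
              | Vec.lookup∘tabulate letter j =
        lookup-AllPairs sorted (subst₂ _<_ (sym (Fin.toℕ-inject≤ i m<l)) (sym (Fin.toℕ-inject≤ j m<l)) i<j)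

      -- The first letter of a pattern is not a loop, because reading it shortens the pattern.
      impossible : ⊥
      impossible with find (hit c c-increasing)
      ... | []    , u∈L , _              = []∉L u∈L
      ... | b ∷ u , u∈L , (j , refl) ∷ _ = pop-head-≢ b u (All.lookup (c-loop j) u∈L)

  -- Each letter read either leaves L fixed, which at most k ⊓ m letters do, or decreases size L,
  -- and the factor (k * p) ^ size L pays for the latter; p is a scale that makes k ⊓ m + 1/p integral.
  survivors-bound : .{{_ : NonZero k}} → ∀ p .{{_ : NonZero p}} {m} n {L} → Hitting (suc m) L →
    p ^ n * length (survivors L n) ≤ (k * p) ^ size L * suc ((k ⊓ m) * p) ^ n
  survivors-bound p {m} n {L} hit with [] ∈? L
  ... | yes _ = ℕ.≤-trans (ℕ.≤-reflexive (ℕ.*-zeroʳ (p ^ n))) z≤n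
  survivors-bound p zero {L} hit | no _ =
    ℕ.≤-trans (ℕ.m^n>0 (k * p) {{ℕ.m*n≢0 k p}} (size L)) (ℕ.≤-reflexive (sym (ℕ.*-identityʳ _)))
  -- After division by `k`, a loop costs at most `p * Z` and any other letter at most `Z / k`. Hence
  -- `d` loops and `k` other letters cost `(d * p + 1) * Z`; multiplying through by `k` avoids the
  -- fraction.
  survivors-bound p {m} (suc n) {L} hit | no []∉L = ℕ.*-cancelˡ-≤ k (begin
    k * (p ^ suc n * length ws)                    ≡⟨ ℕ.*-assoc k (p ^ suc n) (length ws) ⟨
    (k * p ^ suc n) * length ws                    ≤⟨ length-concatMap-≤ (loop? L) extend (k * p ^ suc n) loop jump (allFin k) ⟩
    length (filter (loop? L) (allFin k)) * (k * (p * Z)) + length (allFin k) * Z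
      ≤⟨ ℕ.+-mono-≤ (ℕ.*-monoˡ-≤ (k * (p * Z)) (loops-≤ hit []∉L)) (ℕ.≤-reflexive (cong (_* Z) (List.length-tabulate {n = k} id))) ⟩
    d * (k * (p * Z)) + k * Z                      ≡⟨ collect d k p ((k * p) ^ size L) (suc (d * p) ^ n) ⟩
    k * ((k * p) ^ size L * suc (d * p) ^ suc n)   ∎)
    where
    open ℕ.≤-Reasoning
    d = k ⊓ m
    Z = (k * p) ^ size L * suc (d * p) ^ n
    extend : Fin k → List (Vec (Fin k) (suc n))
    extend a = map (a ∷_) (survivors (step a L) n)
    ws = concatMap extend (allFin k)

    collect : ∀ d k p x y → d * (k * (p * (x * y))) + k * (x * y) ≡ k * (x * (suc (d * p) * y))
    collect = solve-∀

    reassoc : ∀ k p x y → k * (p * x) * y ≡ k * (p * (x * y))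
    reassoc = solve-∀

    reassoc′ : ∀ k p x y → k * (p * (x * y)) ≡ k * p * x * y
    reassoc′ = solve-∀

    bound : ∀ a → (k * p ^ suc n) * length (extend a) ≤ k * (p * ((k * p) ^ size (step a L) * suc (d * p) ^ n))
    bound a = begin
      (k * p ^ suc n) * length (extend a)                    ≡⟨ cong ((k * p ^ suc n) *_) (List.length-map (a ∷_) (survivors (step a L) n)) ⟩
      (k * p ^ suc n) * length (survivors (step a L) n)      ≡⟨ reassoc k p (p ^ n) _ ⟩
      k * (p * (p ^ n * length (survivors (step a L) n)))    ≤⟨ ℕ.*-monoʳ-≤ k (ℕ.*-monoʳ-≤ p (survivors-bound p n (step-hitting a hit))) ⟩
      k * (p * ((k * p) ^ size (step a L) * suc (d * p) ^ n)) ∎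

    loop : ∀ a → Loop L a → (k * p ^ suc n) * length (extend a) ≤ k * (p * Z)
    loop a ℓ = subst (λ L′ → (k * p ^ suc n) * length (extend a) ≤ k * (p * ((k * p) ^ size L′ * suc (d * p) ^ n)))
      (List.map-id-local ℓ) (bound a)

    jump : ∀ a → ¬ Loop L a → (k * p ^ suc n) * length (extend a) ≤ Z
    jump a ¬ℓ with step-shrinks a L
    ... | inj₁ ℓ  = contradiction ℓ ¬ℓ
    ... | inj₂ lt = begin
      (k * p ^ suc n) * length (extend a)                     ≤⟨ bound a ⟩
      k * (p * ((k * p) ^ size (step a L) * suc (d * p) ^ n)) ≡⟨ reassoc′ k p _ _ ⟩
      (k * p) ^ suc (size (step a L)) * suc (d * p) ^ n       ≤⟨ ℕ.*-monoˡ-≤ (suc (d * p) ^ n) (ℕ.^-monoʳ-≤ (k * p) {{ℕ.m*n≢0 k p}} lt) ⟩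
      Z ∎

-- Words as ordered partitions into blocks.

lookup-ext : ∀ {A : Set} {n} {v w : Vec A n} → (∀ i → lookup v i ≡ lookup w i) → v ≡ w
lookup-ext {v = v} {w} eq =
  trans (sym (Vec.tabulate∘lookup v)) (trans (Vec.tabulate-cong eq) (Vec.tabulate∘lookup w))

length-vectors : ∀ {A : Set} (xs : List A) n → length (vectors xs n) ≡ length xs ^ n
length-vectors xs zero    = refl
length-vectors xs (suc n) = trans (length-product xs) (cong (length xs *_) (length-vectors xs n))
  where
  length-product : ∀ ys → length (cartesianProductWith _∷_ ys (vectors xs n)) ≡ length ys * length (vectors xs n)
  length-product []       = refl
  length-product (y ∷ ys) = trans (List.length-++ (map (y ∷_) (vectors xs n)))
    (cong₂ _+_ (List.length-map (y ∷_) (vectors xs n)) (length-product ys))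

∈-⋃⁺ : ∀ {n k x} (B : Blocks n k) i → x Subset.∈ lookup B i → x Subset.∈ Subset.⋃ (Vec.toList B)
∈-⋃⁺ (p ∷ B) Fin.zero    x∈p = Subset.x∈p∪q⁺ (inj₁ x∈p)
∈-⋃⁺ (p ∷ B) (Fin.suc i) x∈q = Subset.x∈p∪q⁺ (inj₂ (∈-⋃⁺ B i x∈q))

∈-⋃⁻ : ∀ {n k x} (B : Blocks n k) → x Subset.∈ Subset.⋃ (Vec.toList B) → ∃[ i ] x Subset.∈ lookup B i
∈-⋃⁻ []      x∈ = contradiction x∈ Subset.∉⊥
∈-⋃⁻ (p ∷ B) x∈ with Subset.x∈p∪q⁻ p _ x∈
... | inj₁ x∈p = Fin.zero , x∈p
... | inj₂ x∈⋃ = let i , x∈q = ∈-⋃⁻ B x∈⋃ in Fin.suc i , x∈q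

-- The letter of w at position x is the index of the block that contains x.
toBlocks : ∀ {n k} → Vec (Fin k) n → Blocks n k
toBlocks w = Vec.tabulate λ i → Vec.map (λ a → does (a Fin.≟ i)) w

module _ {n k : ℕ} where

  lookup-toBlocks : ∀ (w : Vec (Fin k) n) i x → lookup (lookup (toBlocks w) i) x ≡ does (lookup w x Fin.≟ i)
  lookup-toBlocks w i x = trans (cong (λ p → lookup p x) (Vec.lookup∘tabulate _ i)) (Vec.lookup-map x _ w)

  ∈-toBlocks⁺ : ∀ (w : Vec (Fin k) n) {i x} → lookup w x ≡ i → x Subset.∈ lookup (toBlocks w) i
  ∈-toBlocks⁺ w {i} {x} eq = Vec.lookup⇒[]= x _ (trans (lookup-toBlocks w i x) (dec-true (lookup w x Fin.≟ i) eq))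

  ∈-toBlocks⁻ : ∀ (w : Vec (Fin k) n) {i x} → x Subset.∈ lookup (toBlocks w) i → lookup w x ≡ i
  ∈-toBlocks⁻ w {i} {x} x∈ with lookup w x Fin.≟ i | trans (sym (lookup-toBlocks w i x)) (Vec.[]=⇒lookup x∈)
  ... | yes eq | _ = eq

  toBlocks-injective : ∀ {v w : Vec (Fin k) n} → toBlocks v ≡ toBlocks w → v ≡ w
  toBlocks-injective {v} {w} eq = lookup-ext λ x →
    sym (∈-toBlocks⁻ w (subst (λ B → x Subset.∈ lookup B (lookup v x)) eq (∈-toBlocks⁺ v refl)))

  toBlocks-disjoint : ∀ (w : Vec (Fin k) n) → Disjoint (toBlocks w)
  toBlocks-disjoint w i j i≢j (x , x∈) = let x∈i , x∈j = Subset.x∈p∩q⁻ _ _ x∈ in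
    i≢j (trans (sym (∈-toBlocks⁻ w x∈i)) (∈-toBlocks⁻ w x∈j))

  toBlocks-covers : ∀ (w : Vec (Fin k) n) → Covers (toBlocks w)
  toBlocks-covers w = Subset.⊆-antisym Subset.⊆⊤ λ {x} _ → ∈-⋃⁺ (toBlocks w) (lookup w x) (∈-toBlocks⁺ w refl)

  -- Covering supplies a block for each element, and disjointness makes it the only one.
  toBlocks-surjective : ∀ (B : Blocks n k) → Disjoint B → Covers B → ∃[ w ] toBlocks w ≡ B
  toBlocks-surjective B disj cov = w , lookup-ext λ i → Subset.⊆-antisym
    (λ {x} x∈ → subst (λ j → x Subset.∈ lookup B j) (∈-toBlocks⁻ w x∈) (w-block x))
    (λ {x} x∈ → ∈-toBlocks⁺ w (unique-block (w-block x) x∈))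
    where
    block : ∀ x → ∃[ i ] x Subset.∈ lookup B i
    block x = ∈-⋃⁻ B (subst (x Subset.∈_) (sym cov) Subset.∈⊤)

    w : Vec (Fin k) n
    w = Vec.tabulate (proj₁ ∘ block)

    w-block : ∀ x → x Subset.∈ lookup B (lookup w x)
    w-block x = subst (λ i → x Subset.∈ lookup B i) (sym (Vec.lookup∘tabulate (proj₁ ∘ block) x)) (proj₂ (block x))

    unique-block : ∀ {x i j} → x Subset.∈ lookup B i → x Subset.∈ lookup B j → i ≡ j
    unique-block {i = i} {j} x∈i x∈j with i Fin.≟ j
    ... | yes eq = eq
    ... | no i≢j = contradiction (_ , Subset.x∈p∩q⁺ (x∈i , x∈j)) (disj i j i≢j)

-- Occurrences of `ρ` and the two bounds on `op*`.

-- Turns an inductive embedding into a map of positions, from which the witness of containment is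
-- read off.
⊑⇒positions : ∀ {A : Set} {m n} (f : Fin m → A) (w : Vec A n) → List.tabulate f ⊑ w →
  Σ[ p ∈ (Fin m → Fin n) ] (∀ {s t} → s Fin.< t → p s Fin.< p t) × (∀ s → lookup w (p s) ≡ f s)
⊑⇒positions {m = zero}  f w e = (λ ()) , (λ {s} → contradiction s Fin.¬Fin0) , λ ()
⊑⇒positions {m = suc m} f (a ∷ w) (skip e) = let p , mono , eq = ⊑⇒positions f w e in
  Fin.suc ∘ p , s≤s ∘ mono , eq
⊑⇒positions {m = suc m} {suc n} f (_ ∷ w) (keep e) with ⊑⇒positions (f ∘ Fin.suc) w e
... | p , mono , eq = q , q-mono , λ { Fin.zero → refl ; (Fin.suc s) → eq s }
  where
  q : Fin (suc m) → Fin (suc n)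
  q Fin.zero    = Fin.zero
  q (Fin.suc s) = Fin.suc (p s)

  q-mono : ∀ {s t} → s Fin.< t → q s Fin.< q t
  q-mono {Fin.zero}  {Fin.suc t} _         = s≤s z≤n
  q-mono {Fin.suc s} {Fin.suc t} (s≤s s<t) = s≤s (mono s<t)

strictMono-reflects-< : ∀ {m n} {p : Fin m → Fin n} → (∀ {s t} → s Fin.< t → p s Fin.< p t) →
  ∀ {s t} → p s Fin.< p t → s Fin.< t
strictMono-reflects-< mono {s} {t} ps<pt with Fin.<-cmp s t
... | tri< s<t _ _  = s<t
... | tri≈ _ refl _ = contradiction ps<pt (Fin.<-irrefl refl)
... | tri> _ _ t<s  = contradiction ps<pt (Fin.<-asym (mono t<s))

increasing? : ∀ {k m} → Decidable (Increasing {k} {m})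
increasing? i = Fin.all? λ a → Fin.all? λ c → (a Fin.<? c) →-dec (lookup i a Fin.<? lookup i c)

module _ {k m : ℕ} (ρ : Permutation′ m) where

  -- Reading the ground set from left to right turns ρ into its inverse.
  pattern-on : Vec (Fin k) m → Fin m → Fin k
  pattern-on c s = lookup c (ρ ⟨$⟩ˡ s)

  patterns : List (List (Fin k))
  patterns = map (List.tabulate ∘ pattern-on) (filter increasing? (vectors (allFin k) m))

  -- The pattern of `c` is a rearrangement of `c`, so it witnesses the invariant at the start of the
  -- run.
  patterns-hitting : Hitting m patterns
  patterns-hitting c inc = Any.map⁺ (lose
    (∈-filter⁺ increasing? (vectors-complete ∈-allFin c) inc)
    (All.tabulate⁺ λ s → ρ ⟨$⟩ˡ s , refl))

  -- Let `p s` be the position matched to letter `s` of the pattern, and put `b j = p (ρ j)`. This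
  -- lies in block `c j` because `ρ⁻¹ (ρ j) = j`, and `b` is ordered like `ρ` because `p` is
  -- strictly increasing.
  ⊑⇒contains : ∀ {n} (w : Vec (Fin k) n) {c} → Increasing c →
    List.tabulate (pattern-on c) ⊑ w → Contains ρ (toBlocks w)
  ⊑⇒contains {n} w {c} inc e with ⊑⇒positions (pattern-on c) w e
  ... | p , mono , eq = c , b , inc
      , (λ j → ∈-toBlocks⁺ w (trans (cong (lookup w) (b-eq j)) (trans (eq (ρ ⟨$⟩ʳ j)) (cong (lookup c) (inverseˡ ρ)))))
      , λ i j → mk⇔
          (λ lt → strictMono-reflects-< mono (subst₂ Fin._<_ (b-eq i) (b-eq j) lt))
          (λ lt → subst₂ Fin._<_ (sym (b-eq i)) (sym (b-eq j)) (mono lt))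
    where
    b : Vec (Fin n) m
    b = Vec.tabulate λ j → p (ρ ⟨$⟩ʳ j)

    b-eq : ∀ j → lookup b j ≡ p (ρ ⟨$⟩ʳ j)
    b-eq = Vec.lookup∘tabulate λ j → p (ρ ⟨$⟩ʳ j)

  -- Every counted sequence of blocks comes from a word; embedding a pattern in that word would
  -- produce a copy of `ρ`, so the word survives.
  op*-≤-survivors : ∀ n → op* n k ρ ≤ length (survivors patterns n)
  op*-≤-survivors n = ℕ.≤-trans
    (unique-⊆⇒length-≤ (Unique.filter⁺ (counted? ρ) (allBlocks-unique n k)) counted⊆)
    (ℕ.≤-reflexive (List.length-map toBlocks (survivors patterns n)))
    where
    counted⊆ : ∀ {B} → B ∈ filter (counted? ρ) (allBlocks n k) → B ∈ map toBlocks (survivors patterns n)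
    counted⊆ {B} B∈ with ∈-filter⁻ (counted? ρ) {xs = allBlocks n k} B∈
    ... | _ , disj , cov , avoids with toBlocks-surjective B disj cov
    ... | w , refl = ∈-map⁺ toBlocks (survivors-complete patterns w (All.map⁺ (All.map
      (λ {c} inc e → avoids (⊑⇒contains w {c} inc e))
      (All.all-filter increasing? (vectors (allFin k) m)))))

  -- Words over the first `d` letters leave all other blocks empty, whereas a copy of `ρ` takes its
  -- `m > d` entries from distinct blocks.
  op*-≥ : ∀ n {d} → d ≤ k → d < m → d ^ n ≤ op* n k ρ
  op*-≥ n {d} d≤k d<m = ℕ.≤-trans
    (ℕ.≤-reflexive (sym (trans (List.length-map embed (vectors (allFin d) n))
      (trans (length-vectors (allFin d) n) (cong (_^ n) (List.length-tabulate {n = d} id))))))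
    (unique-⊆⇒length-≤ (Unique.map⁺ embed-injective (vectors-unique (Unique.allFin⁺ d) n)) embed⊆)
    where
    widen : Fin d → Fin k
    widen a = Fin.inject≤ a d≤k

    embed : Vec (Fin d) n → Blocks n k
    embed v = toBlocks (Vec.map widen v)

    embed-injective : ∀ {v w} → embed v ≡ embed w → v ≡ w
    embed-injective {v} {w} eq = lookup-ext λ x → Fin.inject≤-injective d≤k d≤k _ _
      (trans (sym (Vec.lookup-map x widen v))
        (trans (cong (λ u → lookup u x) (toBlocks-injective eq)) (Vec.lookup-map x widen w)))

    avoids : ∀ v → Avoids ρ (embed v)
    avoids v (i , b , inc , b∈ , _) with Fin.pigeonhole d<m (λ j → lookup v (lookup b j))
    ... | s , t , s<t , eq = Fin.<-irrefl (trans (sym (i-eq s)) (trans (cong widen eq) (i-eq t))) (inc s t s<t)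
      where
      i-eq : ∀ j → widen (lookup v (lookup b j)) ≡ lookup i j
      i-eq j = trans (sym (Vec.lookup-map (lookup b j) widen v)) (∈-toBlocks⁻ (Vec.map widen v) (b∈ j))

    embed⊆ : ∀ {B} → B ∈ map embed (vectors (allFin d) n) → B ∈ filter (counted? ρ) (allBlocks n k)
    embed⊆ B∈ with ∈-map⁻ embed B∈
    ... | v , _ , refl = ∈-filter⁺ (counted? ρ) (allBlocks-complete (embed v))
      (toBlocks-disjoint (Vec.map widen v) , toBlocks-covers (Vec.map widen v) , avoids v)

-- Absorbing a constant factor into the base.

-- Bernoulli's inequality for `1 + 1 / s`, multiplied by `s ^ (n + 1)` to stay within the natural
-- numbers.
bernoulli : ∀ s n → (s + n) * s ^ n ≤ s * suc s ^ n
bernoulli s zero    = ℕ.≤-reflexive (cong (_* 1) (ℕ.+-identityʳ s))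
bernoulli s (suc n) = begin
  -- The extra `n * s ^ n` completes the factor, as `(s + n + 1) * s + n = (s + 1) * (s + n)`.
  (s + suc n) * (s * s ^ n)             ≤⟨ ℕ.m≤m+n _ (n * s ^ n) ⟩
  (s + suc n) * (s * s ^ n) + n * s ^ n ≡⟨ expand s n (s ^ n) ⟩
  suc s * ((s + n) * s ^ n)             ≤⟨ ℕ.*-monoʳ-≤ (suc s) (bernoulli s n) ⟩
  suc s * (s * suc s ^ n)               ≡⟨ swap (suc s) s (suc s ^ n) ⟩
  s * (suc s * suc s ^ n)               ∎
  where
  open ℕ.≤-Reasoning
  expand : ∀ s n x → (s + suc n) * (s * x) + n * x ≡ suc s * ((s + n) * x)
  expand = solve-∀
  swap : ∀ a b c → a * (b * c) ≡ b * (a * c)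
  swap = solve-∀

-- Raising the base from `s` to `s + 1` gains a factor of at least `(s + n) / s`, which exceeds `C`
-- once `n ≥ s * C`.
*-^-≤-suc-^ : ∀ s .{{_ : NonZero s}} C {n} → s * C ≤ n → C * s ^ n ≤ suc s ^ n
*-^-≤-suc-^ s C {n} sC≤n = ℕ.*-cancelˡ-≤ s (begin
  s * (C * s ^ n)   ≡⟨ ℕ.*-assoc s C (s ^ n) ⟨
  s * C * s ^ n     ≤⟨ ℕ.*-monoˡ-≤ (s ^ n) (ℕ.≤-trans sC≤n (ℕ.m≤n+m n s)) ⟩
  (s + n) * s ^ n   ≤⟨ bernoulli s n ⟩
  s * suc s ^ n     ∎)
  where open ℕ.≤-Reasoning

-- Natural numbers among the rationals.

-- Unnormalised fractions compute without reduction to lowest terms, so order and arithmetic of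
-- `fromℕ` are checked there and pulled back.
toℚᵘ-fromℕ : ∀ a → toℚᵘ (fromℕ a) ℚᵘ.≃ mkℚᵘ (+ a) 0
toℚᵘ-fromℕ a = ℚ.toℚᵘ-fromℚᵘ (mkℚᵘ (+ a) 0)

fromℕ-mono-≤ : ∀ {a b} → a ≤ b → fromℕ a ℚ.≤ fromℕ b
fromℕ-mono-≤ {a} {b} a≤b = ℚ.toℚᵘ-cancel-≤
  (ℚᵘ.≤-respˡ-≃ (ℚᵘ.≃-sym (toℚᵘ-fromℕ a)) (ℚᵘ.≤-respʳ-≃ (ℚᵘ.≃-sym (toℚᵘ-fromℕ b))
    (*≤* (ℤ.*-monoʳ-≤-nonNeg (+ 1) (ℤ.+≤+ a≤b)))))

fromℕ-+ : ∀ a b → fromℕ (a + b) ≡ fromℕ a ℚ.+ fromℕ b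
fromℕ-+ a b = ℚ.toℚᵘ-injective (begin
  toℚᵘ (fromℕ (a + b))                 ≈⟨ toℚᵘ-fromℕ (a + b) ⟩
  mkℚᵘ (+ (a + b)) 0                   ≈⟨ *≡* (cong (λ z → z ℤ.* + 1) (sym (cong₂ ℤ._+_ (ℤ.*-identityʳ (+ a)) (ℤ.*-identityʳ (+ b))))) ⟩
  mkℚᵘ (+ a) 0 ℚᵘ.+ mkℚᵘ (+ b) 0       ≈⟨ ℚᵘ.+-cong (toℚᵘ-fromℕ a) (toℚᵘ-fromℕ b) ⟨
  toℚᵘ (fromℕ a) ℚᵘ.+ toℚᵘ (fromℕ b)   ≈⟨ ℚ.toℚᵘ-homo-+ (fromℕ a) (fromℕ b) ⟨
  toℚᵘ (fromℕ a ℚ.+ fromℕ b)           ∎)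
  where open ℚᵘ.≃-Reasoning

fromℕ-* : ∀ a b → fromℕ (a * b) ≡ fromℕ a ℚ.* fromℕ b
fromℕ-* a b = ℚ.toℚᵘ-injective (begin
  toℚᵘ (fromℕ (a * b))                 ≈⟨ toℚᵘ-fromℕ (a * b) ⟩
  mkℚᵘ (+ (a * b)) 0                   ≈⟨ *≡* (cong (λ z → z ℤ.* + 1) (ℤ.pos-* a b)) ⟩
  mkℚᵘ (+ a) 0 ℚᵘ.* mkℚᵘ (+ b) 0       ≈⟨ ℚᵘ.*-cong (toℚᵘ-fromℕ a) (toℚᵘ-fromℕ b) ⟨
  toℚᵘ (fromℕ a) ℚᵘ.* toℚᵘ (fromℕ b)   ≈⟨ ℚ.toℚᵘ-homo-* (fromℕ a) (fromℕ b) ⟨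
  toℚᵘ (fromℕ a ℚ.* fromℕ b)           ∎)
  where open ℚᵘ.≃-Reasoning

fromℕ-^ : ∀ a n → fromℕ (a ^ n) ≡ fromℕ a ^ℚ n
fromℕ-^ a zero    = refl
fromℕ-^ a (suc n) = trans (fromℕ-* a (a ^ n)) (cong (fromℕ a ℚ.*_) (fromℕ-^ a n))

fromℕ-pos : ∀ a .{{_ : NonZero a}} → 0ℚ ℚ.< fromℕ a
fromℕ-pos (suc a) = ℚ.<-≤-trans (ℚ.positive⁻¹ 1ℚ) (fromℕ-mono-≤ {1} {suc a} (s≤s z≤n))

archimedean : ∀ c .{{_ : NonZero c}} {ε} → 0ℚ ℚ.< ε → ∃[ q ] NonZero q × fromℕ c ℚ.≤ fromℕ q ℚ.* ε
archimedean (suc c) {ε} 0<ε with ε | ℚ.positive 0<ε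
... | η@(mkℚ +[1+ j ] d _) | _ = q , _ , ℚ.toℚᵘ-cancel-≤
  (ℚᵘ.≤-respˡ-≃ (ℚᵘ.≃-sym (toℚᵘ-fromℕ (suc c)))
    (ℚᵘ.≤-respʳ-≃ (ℚᵘ.≃-sym (ℚᵘ.≃-trans (ℚ.toℚᵘ-homo-* (fromℕ q) η) (ℚᵘ.*-congʳ (toℚᵘ-fromℕ q))))
      (*≤* (ℤ.+≤+ bound))))
  where
  -- Here `ε = (j + 1) / (d + 1)`, so that `q * ε = (c + 1) * (j + 1)`.
  q = suc c * suc d
  open ℕ.≤-Reasoning
  bound : suc c * (1 * suc d) ≤ q * suc j * 1
  bound = begin
    suc c * (1 * suc d) ≡⟨ cong (suc c *_) (ℕ.*-identityˡ (suc d)) ⟩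
    q                   ≤⟨ ℕ.m≤m*n q (suc j) ⟩
    q * suc j           ≡⟨ ℕ.*-identityʳ (q * suc j) ⟨
    q * suc j * 1       ∎

-- The chain is `a ≤ (b / q) ^ n ≤ r ^ n`, with the scale `q` cleared. It brings integer bounds into
-- the form that the upper cut of `root` asks for.
^-cancel-≤ : ∀ {q} n {a b r} .{{_ : NonZero q}} → fromℕ b ℚ.≤ fromℕ q ℚ.* r →
  q ^ n * a ≤ b ^ n → fromℕ a ℚ.≤ r ^ℚ n
^-cancel-≤ {q} n {a} {b} {r} b≤qr qⁿa≤bⁿ = ℚ.*-cancelˡ-≤-pos (fromℕ q ^ℚ n)
  {{ℚ.positive (ℚ-Powers.^-pos n (fromℕ-pos q))}} (begin
  fromℕ q ^ℚ n ℚ.* fromℕ a    ≡⟨ cong (ℚ._* fromℕ a) (fromℕ-^ q n) ⟨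
  fromℕ (q ^ n) ℚ.* fromℕ a   ≡⟨ fromℕ-* (q ^ n) a ⟨
  fromℕ (q ^ n * a)           ≤⟨ fromℕ-mono-≤ qⁿa≤bⁿ ⟩
  fromℕ (b ^ n)               ≡⟨ fromℕ-^ b n ⟩
  fromℕ b ^ℚ n                ≤⟨ ℚ-Powers.^-mono-≤ n (ℚ-Powers.0≤fromℕ b) b≤qr ⟩
  (fromℕ q ℚ.* r) ^ℚ n        ≡⟨ ^-distrib-* (fromℕ q) r n ⟩
  fromℕ q ^ℚ n ℚ.* r ^ℚ n     ∎)
  where open ℚ.≤-Reasoning

-- Convergence of the roots.

p<p+q : ∀ p {q} → 0ℚ ℚ.< q → p ℚ.< p ℚ.+ q
p<p+q p 0<q = subst (ℚ._< p ℚ.+ _) (ℚ.+-identityʳ p) (ℚ.+-monoʳ-< p 0<q)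

-- For large `n` the root lies between `d` and `d + 2 / q`, and `q` is chosen with `2 / q ≤ δ < ε`.
root-squeeze : ∀ {a : ℕ → ℕ} {d} → (∀ n → d ^ n ≤ a n) →
  (∀ q .{{_ : NonZero q}} → ∃[ N ] ∀ n → N ≤ n → q ^ n * a n ≤ suc (suc (d * q)) ^ n) →
  (λ n → root n (a n)) ⟶ fromℚ (fromℕ d)
root-squeeze {a} {d} lower upper ε 0<ε
  with δ , 0<δ , δ<ε ← ℚ.<-dense 0<ε
  with q , q≢0 , 2≤qδ ← archimedean 2 0<δ
  with N , bound ← upper q {{q≢0}} = N , λ n N≤n →
    -- The root is at most `D + δ`; the intermediate `s` makes `D + s` lie strictly between it and
    -- `D + ε`.
    ( let s , δ<s , s<ε = ℚ.<-dense δ<ε in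
      D ℚ.+ s
    , (D ℚ.+ δ , ℚ.+-monoʳ-< D δ<s , ℚ.≤-trans 0≤D (ℚ.<⇒≤ (p<p+q D 0<δ))
        , ^-cancel-≤ {q} n {{q≢0}} (≤q[D+δ] 2≤qδ) (bound n N≤n))
    , subst (D ℚ.+ s ℚ.- ε ℚ.<_) (ℚ-Arithmetic.p+q-q D ε) (ℚ.+-monoˡ-< (ℚ.- ε) (ℚ.+-monoʳ-< D s<ε)))
  -- The root is at least `D`, so `D + δ` lies strictly between `D` and the root plus `ε`.
  , ( D ℚ.+ δ , p<p+q D 0<δ
    , D , subst (D ℚ.+ δ ℚ.- ε ℚ.<_) (ℚ-Arithmetic.p+q-q D ε) (ℚ.+-monoˡ-< (ℚ.- ε) (ℚ.+-monoʳ-< D δ<ε))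
    , 0≤D , subst (ℚ._≤ fromℕ (a n)) (fromℕ-^ d n) (fromℕ-mono-≤ (lower n)))
  where
  D = fromℕ d
  0≤D = ℚ-Powers.0≤fromℕ d

  ≤q[D+δ] : ∀ {q δ} → fromℕ 2 ℚ.≤ fromℕ q ℚ.* δ → fromℕ (suc (suc (d * q))) ℚ.≤ fromℕ q ℚ.* (D ℚ.+ δ)
  ≤q[D+δ] {q} {δ} 2≤qδ = begin
    fromℕ (suc (suc (d * q)))           ≡⟨ fromℕ-+ 2 (d * q) ⟩
    fromℕ 2 ℚ.+ fromℕ (d * q)           ≤⟨ ℚ.+-monoˡ-≤ (fromℕ (d * q)) 2≤qδ ⟩
    fromℕ q ℚ.* δ ℚ.+ fromℕ (d * q)     ≡⟨ cong (fromℕ q ℚ.* δ ℚ.+_) (trans (cong fromℕ (ℕ.*-comm d q)) (fromℕ-* q d)) ⟩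
    fromℕ q ℚ.* δ ℚ.+ fromℕ q ℚ.* D     ≡⟨ ℚ.+-comm (fromℕ q ℚ.* δ) (fromℕ q ℚ.* D) ⟩
    fromℕ q ℚ.* D ℚ.+ fromℕ q ℚ.* δ     ≡⟨ ℚ.*-distribˡ-+ (fromℕ q) D δ ⟨
    fromℕ q ℚ.* (D ℚ.+ δ)               ∎
    where open ℚ.≤-Reasoning

theorem10 : (k : ℕ) .{{_ : NonZero k}} (m : ℕ) → 2 ≤ m → (ρ : Permutation′ m) →
    ∃[ x ] ((λ n → root n (op* n k ρ)) ⟶ x) × (1ℝ ≤ℝ x)
theorem10 k (suc m) (s≤s 1≤m) ρ =
    fromℚ (fromℕ d)
  , root-squeeze (λ n → op*-≥ ρ n (ℕ.m⊓n≤m k m) (s≤s (ℕ.m⊓n≤n k m))) upper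
  , λ _ q<1 → ℚ.<-≤-trans q<1 (fromℕ-mono-≤ {1} {d} (ℕ.⊓-glb (>-nonZero⁻¹ k) 1≤m))
  where
  -- After matching on `suc m`, this `m` is one less than the length of `ρ`.
  d = k ⊓ m

  upper : ∀ q .{{_ : NonZero q}} → ∃[ N ] ∀ n → N ≤ n → q ^ n * op* n k ρ ≤ suc (suc (d * q)) ^ n
  -- From this threshold on, adding one to the base outweighs `C`, which depends on `q` but not on
  -- `n`.
  upper q = suc (d * q) * C , λ n N≤n → begin
    q ^ n * op* n k ρ                ≤⟨ ℕ.*-monoʳ-≤ (q ^ n) (op*-≤-survivors {k} ρ n) ⟩
    q ^ n * length (survivors L n)   ≤⟨ survivors-bound q n (patterns-hitting ρ) ⟩
    C * suc (d * q) ^ n              ≤⟨ *-^-≤-suc-^ (suc (d * q)) C N≤n ⟩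
    suc (suc (d * q)) ^ n            ∎
    where
    open ℕ.≤-Reasoning
    L = patterns {k} ρ
    C = (k * q) ^ size L
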